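{- Let $\Sigma$ be a signature, $V$ a set of variables, and $t_1=t_2$ a one-drop equation with $t_1,t_2\in\Sigma^*V$ and $\mathrm{Var}(t_1)\cup\mathrm{Var}(t_2)=V$. Let $T$ be a monoidal monad on $\mathbf{Set}$. If $T$ preserves $t_1=t_2$, then $T$ is affine.
   Context: All monads are on $\mathbf{Set}$ with its Cartesian monoidal structure. A monoidal monad is a monad $(T,\eta,\mu)$ with a natural transformation $\psi_{X,Y}\colon TX\times TY\to T(X\times Y)$ making $T$ lax monoidal with unit $\psi^0=\eta_1$, such that $\eta,\mu$ are monoidal natural transformations (equivalently, a commutative monad with its double strength). $\psi^n$ denotes the $n$-ary version built associatively from $\psi$ ($\psi^1=\mathrm{id}$, $\psi^0=\eta_1$). $\Sigma^*V$ is the set of $\Sigma$-terms over variables $V$, $\mathrm{Var}(t)$ the variables occurring in $t$. For a $\Sigma$-algebra $\mathcal A$ with carrier $A$, the lifted algebra $\widehat T\mathcal A$ has carrier $TA$ and operations $\sigma_{\widehat T\mathcal A}=T\sigma_{\mathcal A}\circ\psi^{\mathrm{ar}(\sigma)}$. $T$ preserves $t_1=t_2$ if for every $\Sigma$-algebra $\mathcal A$ with $\mathcal A\models t_1=t_2$ we have $\widehat T\mathcal A\models t_1=t_2$. $T$ is affine if $T1$ is a one-element set (equivalently $\langle T\pi_1,T\pi_2\rangle\circ\psi_{A,B}=\mathrm{id}_{TA\times TB}$ for all $A,B$). An equation is one-drop if some variable occurs exactly once on one side and does not occur on the other side. -}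

module Defs where

open import Data.Fin.Base using (Fin)
open import Data.Nat.Base using (ℕ; suc)
open import Data.Product.Base
  using (_×_; _,_; proj₁; proj₂; map; assocʳ; Σ; ∃-syntax)
open import Data.Sum.Base using (_⊎_)
open import Data.Unit.Polymorphic.Base using (⊤; tt)
open import Data.Vec.Recursive using (_^_; lookup)
open import Function.Base using (id; _∘_)
open import Level using (Level)
open import Relation.Binary.PropositionalEquality.Core using (_≡_; _≗_)
open import Relation.Nullary.Negation.Core using (¬_)

private
  variable
    ℓ : Level

-- The category Set is Set ℓ with functions up to pointwise equality _≗_.
-- Without function extensionality, well-definedness of the functor on
-- morphisms has to be demanded explicitly (fmap-cong).

record Monad (ℓ : Level) : Set (Level.suc ℓ) where
  field
    T    : Set ℓ → Set ℓ
    fmap : {X Y : Set ℓ} → (X → Y) → T X → T Y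
    η    : {X : Set ℓ} → X → T X
    μ    : {X : Set ℓ} → T (T X) → T X

    fmap-cong : {X Y : Set ℓ} {f g : X → Y} → f ≗ g → fmap f ≗ fmap g
    fmap-id   : {X : Set ℓ} → fmap {X} id ≗ id
    fmap-∘    : {X Y Z : Set ℓ} (g : Y → Z) (f : X → Y) →
                fmap (g ∘ f) ≗ fmap g ∘ fmap f

    η-natural : {X Y : Set ℓ} (f : X → Y) → fmap f ∘ η ≗ η ∘ f
    μ-natural : {X Y : Set ℓ} (f : X → Y) → fmap f ∘ μ ≗ μ ∘ fmap (fmap f)

    μ-identityˡ : {X : Set ℓ} → μ {X} ∘ η ≗ id
    μ-identityʳ : {X : Set ℓ} → μ {X} ∘ fmap η ≗ id
    μ-assoc     : {X : Set ℓ} → μ {X} ∘ μ ≗ μ ∘ fmap μ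

-- Since ψ⁰ is η at ⊤, the nullary coherence conditions for η and μ
-- (η tt ≡ ψ⁰ tt and μ (fmap ψ⁰ (ψ⁰ tt)) ≡ ψ⁰ tt) follow from the monad
-- laws and are not listed.

record MonoidalMonad (ℓ : Level) : Set (Level.suc ℓ) where
  field
    monad : Monad ℓ

  open Monad monad public

  ψ⁰ : ⊤ → T ⊤
  ψ⁰ = η

  field
    ψ : {X Y : Set ℓ} → T X × T Y → T (X × Y)

    ψ-natural : {X X′ Y Y′ : Set ℓ} (f : X → X′) (g : Y → Y′) →
                fmap (map f g) ∘ ψ ≗ ψ ∘ map (fmap f) (fmap g)

    ψ-identityˡ : {Y : Set ℓ} (y : T Y) → fmap proj₂ (ψ (ψ⁰ tt , y)) ≡ y
    ψ-identityʳ : {X : Set ℓ} (x : T X) → fmap proj₁ (ψ (x , ψ⁰ tt)) ≡ x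
    ψ-assoc     : {X Y Z : Set ℓ} (x : T X) (y : T Y) (z : T Z) →
                  fmap assocʳ (ψ (ψ (x , y) , z)) ≡ ψ (x , ψ (y , z))

    η-monoidal : {X Y : Set ℓ} (x : X) (y : Y) → ψ (η x , η y) ≡ η (x , y)
    μ-monoidal : {X Y : Set ℓ} (x : T (T X)) (y : T (T Y)) →
                 μ (fmap ψ (ψ (x , y))) ≡ ψ (μ x , μ y)

  ψⁿ : {X : Set ℓ} (n : ℕ) → T X ^ n → T (X ^ n)
  ψⁿ 0               = ψ⁰
  ψⁿ 1               = id
  ψⁿ (suc n@(suc _)) = λ (x , xs) → ψ (x , ψⁿ n xs)

  Affine : Set ℓ
  Affine = ∃[ c ] ((x : T ⊤) → x ≡ c)

record Signature (ℓ : Level) : Set (Level.suc ℓ) where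
  field
    Op : Set ℓ
    ar : Op → ℕ

module _ (S : Signature ℓ) where
  open Signature S

  record Algebra : Set (Level.suc ℓ) where
    field
      Carrier : Set ℓ
      ⟦_⟧     : (σ : Op) → Carrier ^ ar σ → Carrier

  data Term (V : Set ℓ) : Set ℓ where
    var : V → Term V
    op  : (σ : Op) → Term V ^ ar σ → Term V

module _ {S : Signature ℓ} where
  open Signature S

  module _ (A : Algebra S) {V : Set ℓ} (ρ : V → Algebra.Carrier A) where
    open Algebra A

    eval  : Term S V → Carrier
    evalⁿ : (n : ℕ) → Term S V ^ n → Carrier ^ n

    eval (var x)   = ρ x
    eval (op σ ts) = ⟦ σ ⟧ (evalⁿ (ar σ) ts)

    evalⁿ 0               _        = tt
    evalⁿ 1               t        = eval t
    evalⁿ (suc n@(suc _)) (t , ts) = eval t , evalⁿ n ts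

  infix 4 _⊨_≈_
  _⊨_≈_ : Algebra S → {V : Set ℓ} → Term S V → Term S V → Set ℓ
  A ⊨ t₁ ≈ t₂ = ∀ ρ → eval A ρ t₁ ≡ eval A ρ t₂

  module _ {V : Set ℓ} where

    -- An element of x ∈Var t is an occurrence (a position) of x in t.
    infix 4 _∈Var_
    data _∈Var_ (x : V) : Term S V → Set ℓ where
      here  : x ∈Var var x
      there : ∀ {σ ts} (i : Fin (ar σ)) → x ∈Var lookup ts i → x ∈Var op σ ts

    OccursOnce : V → Term S V → Set ℓ
    OccursOnce x t = Σ (x ∈Var t) λ p → ∀ q → q ≡ p

    OneDrop : Term S V → Term S V → Set ℓ
    OneDrop t₁ t₂ = ∃[ x ]
      ((OccursOnce x t₁ × ¬ x ∈Var t₂) ⊎ (OccursOnce x t₂ × ¬ x ∈Var t₁))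

module _ (M : MonoidalMonad ℓ) {S : Signature ℓ} where
  open MonoidalMonad M

  T̂ : Algebra S → Algebra S
  T̂ A = record
    { Carrier = T Carrier
    ; ⟦_⟧     = λ σ → fmap ⟦ σ ⟧ ∘ ψⁿ (ar σ)
    }
    where open Algebra A; open Signature S

  Preserves : {V : Set ℓ} → Term S V → Term S V → Set (Level.suc ℓ)
  Preserves t₁ t₂ = (A : Algebra S) → A ⊨ t₁ ≈ t₂ → T̂ A ⊨ t₁ ≈ t₂

{-# OPTIONS --safe #-}

-- Test preservation on the one-element algebra, which satisfies every equation.
-- Its lifting has carrier T 1, a monoid under ψ with unit η, and each operation
-- is the product of its arguments.  Send the dropped variable x to an arbitrary
-- u in T 1 and all other variables to η: the side in which x occurs once
-- evaluates to u and the other side to η, so u = η.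

module Submission where

open import Defs
open import Data.Fin.Base using (Fin; zero; suc)
open import Data.Fin.Properties using (_≟_; suc-injective; 0≢1+n)
open import Data.Nat.Base using (ℕ; suc)
open import Data.Product.Base using (_,_; map)
open import Data.Sum.Base using (_⊎_; inj₁; inj₂; swap)
open import Data.Unit.Polymorphic.Base using (⊤; tt)
open import Data.Vec.Recursive using (_^_; lookup)
open import Function.Base using (id; _∘_; const)
open import Level using (Level)
open import Relation.Binary.PropositionalEquality
  using (_≡_; _≢_; refl; sym; trans; cong; cong₂; module ≡-Reasoning)
open import Relation.Nullary using (¬_; Dec; yes; no; contradiction)

private
  variable
    ℓ : Level

module _ {S : Signature ℓ} {V : Set ℓ} where
  open Signature S

  there-injectiveˡ : ∀ {x : V} {σ} {ts : Term S V ^ ar σ} {i j}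
    {p : x ∈Var lookup ts i} {q : x ∈Var lookup ts j} →
    _≡_ {A = x ∈Var op σ ts} (there i p) (there j q) → i ≡ j
  there-injectiveˡ refl = refl

  there-injectiveʳ : ∀ {x : V} {σ} {ts : Term S V ^ ar σ} {i}
    {p q : x ∈Var lookup ts i} →
    _≡_ {A = x ∈Var op σ ts} (there i p) (there i q) → p ≡ q
  there-injectiveʳ refl = refl

  -- V need not have decidable equality, but positions in a term do, and
  -- a position determines the variable occurring there.
  once⇒dec : ∀ {x y : V} {t : Term S V} (p : x ∈Var t) → (∀ q → q ≡ p) →
    y ∈Var t → Dec (y ≡ x)
  once⇒dec here unique here = yes refl
  once⇒dec (there i p) unique (there j q) with j ≟ i
  ... | yes refl = once⇒dec p (λ r → there-injectiveʳ (unique (there i r))) q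
  ... | no j≢i   = no λ { refl → j≢i (there-injectiveˡ (unique (there j q))) }

module _ (M : MonoidalMonad ℓ) where
  open MonoidalMonad M
  open ≡-Reasoning

  ! : {X : Set ℓ} → X → ⊤ {ℓ}
  ! = const tt

  -- This unfolds to the interpretation in `T̂ M 𝟙` of any operation of arity `n`, so facts about
  -- `∏` apply to evaluated terms directly.
  ∏ : (n : ℕ) → T ⊤ ^ n → T ⊤
  ∏ n = fmap ! ∘ ψⁿ n

  ∏-cons : ∀ n u (us : T ⊤ ^ suc n) →
    ∏ (suc (suc n)) (u , us) ≡ fmap ! (ψ (u , ∏ (suc n) us))
  ∏-cons n u us = begin
    -- `!` is the same function as `! ∘ map id !`; naturality of `ψ` then collapses the tail alone.
    fmap ! (ψ (u , w))                    ≡⟨ fmap-∘ ! (map id !) (ψ (u , w)) ⟩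
    fmap ! (fmap (map id !) (ψ (u , w)))  ≡⟨ cong (fmap !) (ψ-natural id ! (u , w)) ⟩
    fmap ! (ψ (fmap id u , fmap ! w))     ≡⟨ cong (λ v → fmap ! (ψ (v , fmap ! w))) (fmap-id u) ⟩
    fmap ! (ψ (u , fmap ! w))             ∎
    where w = ψⁿ (suc n) us

  -- On `⊤` the eta rule identifies `!` with `id`, and `proj₁`, `proj₂` on `⊤ × ⊤` with `!`. The
  -- identity laws of `ψ` thus become the unit laws of the monoid `T ⊤`.
  ∏-η : ∀ n (us : T ⊤ ^ n) → (∀ i → lookup us i ≡ η tt) → ∏ n us ≡ η tt
  ∏-η 0             us       us≡η = η-natural ! tt
  ∏-η 1             u        us≡η = trans (fmap-id u) (us≡η zero)
  ∏-η (suc (suc n)) (u , us) us≡η = begin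
    ∏ (suc (suc n)) (u , us)          ≡⟨ ∏-cons n u us ⟩
    fmap ! (ψ (u , ∏ (suc n) us))     ≡⟨ cong₂ (λ a b → fmap ! (ψ (a , b))) (us≡η zero) (∏-η (suc n) us (us≡η ∘ suc)) ⟩
    fmap ! (ψ (η tt , η tt))          ≡⟨ ψ-identityˡ (η tt) ⟩
    η tt                              ∎

  -- Induction on the position: factors before `i` are removed one at a time by the left unit law,
  -- and those after it form a product equal to `η tt`, removed by the right one.
  ∏-single : ∀ n (us : T ⊤ ^ n) i → (∀ j → j ≢ i → lookup us j ≡ η tt) →
    ∏ n us ≡ lookup us i
  ∏-single 1             u        zero    _    = fmap-id u
  ∏-single (suc (suc n)) (u , us) zero    rest = begin
    ∏ (suc (suc n)) (u , us)          ≡⟨ ∏-cons n u us ⟩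
    fmap ! (ψ (u , ∏ (suc n) us))     ≡⟨ cong (λ b → fmap ! (ψ (u , b))) (∏-η (suc n) us (λ j → rest (suc j) (0≢1+n ∘ sym))) ⟩
    fmap ! (ψ (u , η tt))             ≡⟨ ψ-identityʳ u ⟩
    u                                 ∎
  ∏-single (suc (suc n)) (u , us) (suc i) rest = begin
    ∏ (suc (suc n)) (u , us)          ≡⟨ ∏-cons n u us ⟩
    fmap ! (ψ (u , ∏ (suc n) us))     ≡⟨ cong₂ (λ a b → fmap ! (ψ (a , b))) (rest zero 0≢1+n)
                                           (∏-single (suc n) us i (λ j j≢i → rest (suc j) (j≢i ∘ suc-injective))) ⟩
    fmap ! (ψ (η tt , lookup us i))   ≡⟨ ψ-identityˡ (lookup us i) ⟩
    lookup us i                       ∎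

  module _ {S : Signature ℓ} where
    open Signature S

    lookup-evalⁿ : (A : Algebra S) {V : Set ℓ} (ρ : V → Algebra.Carrier A) →
      ∀ n (ts : Term S V ^ n) i →
      lookup (evalⁿ A ρ n ts) i ≡ eval A ρ (lookup ts i)
    lookup-evalⁿ A ρ 1             t        zero    = refl
    lookup-evalⁿ A ρ (suc (suc n)) (t , ts) zero    = refl
    lookup-evalⁿ A ρ (suc (suc n)) (t , ts) (suc i) = lookup-evalⁿ A ρ (suc n) ts i

    𝟙 : Algebra S
    𝟙 = record { Carrier = ⊤ ; ⟦_⟧ = λ _ → ! }

    module _ {V : Set ℓ} (ρ : V → T ⊤) where

      ⟦_⟧ᵀ : Term S V → T ⊤
      ⟦_⟧ᵀ = eval (T̂ M 𝟙) ρ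

      eval-η  : ∀ t → (∀ y → y ∈Var t → ρ y ≡ η tt) → ⟦ t ⟧ᵀ ≡ η tt
      -- Follows the recursion of `evalⁿ` along the tuple, which keeps the induction structural.
      evalⁿ-η : ∀ n (ts : Term S V ^ n) →
        (∀ i y → y ∈Var lookup ts i → ρ y ≡ η tt) →
        ∀ i → lookup (evalⁿ (T̂ M 𝟙) ρ n ts) i ≡ η tt

      eval-η (var x)   ρ≡η = ρ≡η x here
      eval-η (op σ ts) ρ≡η =
        ∏-η (ar σ) _ (evalⁿ-η (ar σ) ts (λ i y q → ρ≡η y (there i q)))

      evalⁿ-η 1             t        ρ≡η zero    = eval-η t (ρ≡η zero)
      evalⁿ-η (suc (suc n)) (t , ts) ρ≡η zero    = eval-η t (ρ≡η zero)
      evalⁿ-η (suc (suc n)) (t , ts) ρ≡η (suc i) = evalⁿ-η (suc n) ts (ρ≡η ∘ suc) i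

      -- Induction on the occurrence `p`. Its uniqueness passes to the argument containing it and
      -- keeps `x` out of all other arguments, which therefore evaluate to the unit.
      eval-once : ∀ {x} → (∀ y → y ≢ x → ρ y ≡ η tt) →
        ∀ {t} (p : x ∈Var t) → (∀ q → q ≡ p) → ⟦ t ⟧ᵀ ≡ ρ x
      eval-once     ρ≡η here unique = refl
      eval-once {x} ρ≡η (there {σ} {ts} i p) unique = begin
        ⟦ op σ ts ⟧ᵀ                               ≡⟨ ∏-single (ar σ) _ i others ⟩
        lookup (evalⁿ (T̂ M 𝟙) ρ (ar σ) ts) i      ≡⟨ lookup-evalⁿ (T̂ M 𝟙) ρ (ar σ) ts i ⟩
        ⟦ lookup ts i ⟧ᵀ                           ≡⟨ eval-once ρ≡η p (λ q → there-injectiveʳ (unique (there i q))) ⟩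
        ρ x                                        ∎
        where
        others : ∀ j → j ≢ i → lookup (evalⁿ (T̂ M 𝟙) ρ (ar σ) ts) j ≡ η tt
        others j j≢i = trans (lookup-evalⁿ (T̂ M 𝟙) ρ (ar σ) ts j)
          (eval-η (lookup ts j) λ y q → ρ≡η y λ { refl →
            j≢i (there-injectiveˡ (unique (there j q))) })

    drop⇒affine : {V : Set ℓ} {t₁ t₂ : Term S V} {x : V} →
      OccursOnce x t₁ → ¬ x ∈Var t₂ →
      (∀ y → y ∈Var t₁ ⊎ y ∈Var t₂) →
      T̂ M 𝟙 ⊨ t₁ ≈ t₂ → Affine
    drop⇒affine {V} {t₁} {t₂} {x} (p , unique) x∉t₂ cover t₁≈t₂ = η tt , λ u →
      let ρ = λ y → value u (x? y) in begin
      u                           ≡⟨ value-yes u (x? x) ⟨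
      ρ x                         ≡⟨ eval-once ρ (λ y → value-no u (x? y)) p unique ⟨
      eval (T̂ M 𝟙) ρ t₁          ≡⟨ t₁≈t₂ ρ ⟩
      eval (T̂ M 𝟙) ρ t₂          ≡⟨ eval-η ρ t₂ (λ y q → value-no u (x? y) λ { refl → x∉t₂ q }) ⟩
      η tt                        ∎
      where
      -- The valuation needs a case split on `y ≡ x`. The covering hypothesis provides it:
      -- occurrences in `t₁` are compared with `p`, and a variable of `t₂` cannot be `x`.
      x? : ∀ y → Dec (y ≡ x)
      x? y with cover y
      ... | inj₁ q = once⇒dec p unique q
      ... | inj₂ q = no λ { refl → x∉t₂ q }

      -- The decision is an argument, so the two lemmas below hold whatever `x?` returns.
      value : T ⊤ → ∀ {y} → Dec (y ≡ x) → T ⊤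
      value u (yes _) = u
      value u (no _)  = η tt

      value-yes : ∀ u (d : Dec (x ≡ x)) → value u d ≡ u
      value-yes u (yes _)  = refl
      value-yes u (no x≢x) = contradiction refl x≢x

      value-no : ∀ u {y} (d : Dec (y ≡ x)) → y ≢ x → value u d ≡ η tt
      value-no u (yes y≡x) y≢x = contradiction y≡x y≢x
      value-no u (no _)    y≢x = refl

theorem4 : ∀ {ℓ} (S : Signature ℓ) (V : Set ℓ) (t₁ t₂ : Term S V) →
    OneDrop t₁ t₂ →
    (∀ x → x ∈Var t₁ ⊎ x ∈Var t₂) →
    (M : MonoidalMonad ℓ) →
    Preserves M t₁ t₂ →
    MonoidalMonad.Affine M
theorem4 S V t₁ t₂ (x , inj₁ (once , x∉t₂)) cover M preserves =
  -- All elements of `⊤` are equal by eta, so `refl` proves the equation in `𝟙`.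
  drop⇒affine M once x∉t₂ cover (preserves (𝟙 M) λ _ → refl)
theorem4 S V t₁ t₂ (x , inj₂ (once , x∉t₁)) cover M preserves =
  drop⇒affine M once x∉t₁ (swap ∘ cover) (sym ∘ preserves (𝟙 M) (λ _ → refl))
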